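{- For every set $\Phi\cup\{\psi\}\subseteq\mathcal L_!$ of standard formulas, $\Phi\models_{\mathsf{InqI}}\psi$ if and only if $\Phi\models_{\mathsf{IPL}}\psi$.
   Context: Fix a set $\mathcal P$ of atomic sentences. The language $\mathcal L$ is given by $\varphi::=p\mid\bot\mid\varphi\land\varphi\mid\varphi\lor\varphi\mid\varphi\to\varphi\mid\varphi\sqcup\varphi$ with $p\in\mathcal P$, where $\lor$ is standard disjunction and $\sqcup$ denotes inquisitive disjunction. Standard formulas are those with no occurrence of $\sqcup$; their set is $\mathcal L_!$. An intuitionistic Kripke model is $M=\langle W,R,V\rangle$ with $W$ a set (of worlds), $R$ a partial order on $W$, and $V:W\times\mathcal P\to\{0,1\}$ such that $wRw'$ and $V(w,p)=1$ imply $V(w',p)=1$. A team is a set $t\subseteq W$; $R[w]=\{w'\mid wRw'\}$ and $R[t]=\bigcup_{w\in t}R[w]$. Support $M,t\models\varphi$ is defined by: - $M,t\models p$ iff $V(w,p)=1$ for all $w\in t$; - $M,t\models\bot$ iff $t=\emptyset$; - $M,t\models\varphi\land\psi$ iff $M,t\models\varphi$ and $M,t\models\psi$; - $M,t\models\varphi\lor\psi$ iff there are $t',t''$ with $t=t'\cup t''$, $M,t'\models\varphi$ and $M,t''\models\psi$; - $M,t\models\varphi\to\psi$ iff for all $t'\subseteq R[t]$, $M,t'\models\varphi$ implies $M,t'\models\psi$; - $M,t\models\varphi\sqcup\psi$ iff $M,t\models\varphi$ or $M,t\models\psi$. $\Phi\models_{\mathsf{InqI}}\psi$ means: for every intuitionistic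 Kripke model $M$ and team $t$ in $M$, if $M,t\models\varphi$ for all $\varphi\in\Phi$ then $M,t\models\psi$. $\models_{\mathsf{IPL}}$ is the consequence relation of intuitionistic propositional logic in the connectives $\bot,\land,\lor,\to$ (equivalently, preservation of truth at worlds of intuitionistic Kripke models under the usual Kripke clauses). -}

module Defs where

open import Level using (Level; Lift; suc) renaming (_⊔_ to _⊔ˡ_)
open import Data.Bool.Base using (Bool; true)
open import Data.Empty.Polymorphic using () renaming (⊥ to ⊥ᵗ)
open import Data.Product.Base using (∃; ∃-syntax; _×_; proj₁; proj₂)
open import Data.Sum.Base using (_⊎_)
open import Relation.Binary.Core using (Rel)
open import Relation.Binary.Structures using (IsPartialOrder)
open import Relation.Binary.PropositionalEquality.Core using (_≡_)
open import Relation.Unary using (Pred; _∈_; _⊆_; _∪_; _≐_; Empty)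

private variable
  a b : Level
  𝒫 : Set a

infixr 7 _∧_
infixr 6 _∨_ _⊔_
infixr 5 _⇒_

-- _∨_ is standard disjunction, _⊔_ is inquisitive disjunction.
data Formula (𝒫 : Set a) : Set a where
  atom : 𝒫 → Formula 𝒫
  ⊥    : Formula 𝒫
  _∧_ _∨_ _⇒_ _⊔_ : Formula 𝒫 → Formula 𝒫 → Formula 𝒫

-- No occurrence of _⊔_.  Derivations are unique, so ∃ Standard is a
-- subtype of Formula.
data Standard {𝒫 : Set a} : Pred (Formula 𝒫) a where
  atom : ∀ p → Standard (atom p)
  ⊥    : Standard ⊥
  _∧_  : ∀ {φ ψ} → Standard φ → Standard ψ → Standard (φ ∧ ψ)
  _∨_  : ∀ {φ ψ} → Standard φ → Standard ψ → Standard (φ ∨ ψ)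
  _⇒_  : ∀ {φ ψ} → Standard φ → Standard ψ → Standard (φ ⇒ ψ)

StandardFormula : Set a → Set a
StandardFormula 𝒫 = ∃ (Standard {𝒫 = 𝒫})

record Model (𝒫 : Set a) (ℓ : Level) : Set (a ⊔ˡ suc ℓ) where
  field
    W              : Set ℓ
    _R_            : Rel W ℓ
    isPartialOrder : IsPartialOrder _≡_ _R_
    V              : W → 𝒫 → Bool
    persistent     : ∀ {w w′ p} → w R w′ → V w p ≡ true → V w′ p ≡ true

  Team : Set (suc ℓ)
  Team = Pred W ℓ

  R[_] : Team → Team
  R[ t ] w′ = ∃[ w ] (w ∈ t × w R w′)

open Model using (W; Team)

-- Equality of teams is extensional (_≐_).  Support quantifies over teams, so
-- it lives one universe above the model; Lift only adjusts the level.
infix 4 _,_⊨_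
_,_⊨_ : ∀ {ℓ} (M : Model 𝒫 ℓ) → Team M → Formula 𝒫 → Set (suc ℓ)
_,_⊨_ {ℓ = ℓ} M t (atom p) = Lift (suc ℓ) (∀ w → w ∈ t → Model.V M w p ≡ true)
_,_⊨_ {ℓ = ℓ} M t ⊥        = Lift (suc ℓ) (Empty t)
M , t ⊨ φ ∧ ψ = M , t ⊨ φ × M , t ⊨ ψ
M , t ⊨ φ ∨ ψ = ∃[ t′ ] ∃[ t″ ] (t ≐ t′ ∪ t″ × M , t′ ⊨ φ × M , t″ ⊨ ψ)
M , t ⊨ φ ⇒ ψ = ∀ (t′ : Team M) → t′ ⊆ Model.R[_] M t → M , t′ ⊨ φ → M , t′ ⊨ ψ
M , t ⊨ φ ⊔ ψ = M , t ⊨ φ ⊎ M , t ⊨ ψ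

-- In both consequence relations ℓ is the universe of the models.
infix 3 _⊨InqI[_]_
_⊨InqI[_]_ : {𝒫 : Set a} → Pred (Formula 𝒫) b → (ℓ : Level) → Formula 𝒫 →
             Set (a ⊔ˡ b ⊔ˡ suc ℓ)
_⊨InqI[_]_ {𝒫 = 𝒫} Φ ℓ ψ =
  ∀ (M : Model 𝒫 ℓ) (t : Team M) → (∀ φ → φ ∈ Φ → M , t ⊨ φ) → M , t ⊨ ψ

-- Kripke truth at a world, by recursion on the derivation that the formula
-- is standard; there is deliberately no clause for _⊔_.
infix 4 _,_⊩ˢ_ _,_⊩_
_,_⊩ˢ_ : ∀ {ℓ} (M : Model 𝒫 ℓ) → W M → {φ : Formula 𝒫} → Standard φ → Set ℓ
_,_⊩ˢ_ {ℓ = ℓ} M w (atom p) = Lift ℓ (Model.V M w p ≡ true)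
M , w ⊩ˢ ⊥     = ⊥ᵗ
M , w ⊩ˢ φ ∧ ψ = M , w ⊩ˢ φ × M , w ⊩ˢ ψ
M , w ⊩ˢ φ ∨ ψ = M , w ⊩ˢ φ ⊎ M , w ⊩ˢ ψ
M , w ⊩ˢ φ ⇒ ψ = ∀ w′ → Model._R_ M w w′ → M , w′ ⊩ˢ φ → M , w′ ⊩ˢ ψ

_,_⊩_ : ∀ {ℓ} (M : Model 𝒫 ℓ) → W M → StandardFormula 𝒫 → Set ℓ
M , w ⊩ φ = M , w ⊩ˢ proj₂ φ

infix 3 _⊨IPL[_]_
_⊨IPL[_]_ : {𝒫 : Set a} → Pred (StandardFormula 𝒫) b → (ℓ : Level) →
            StandardFormula 𝒫 → Set (a ⊔ˡ b ⊔ˡ suc ℓ)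
_⊨IPL[_]_ {𝒫 = 𝒫} Φ ℓ ψ =
  ∀ (M : Model 𝒫 ℓ) (w : W M) → (∀ φ → φ ∈ Φ → M , w ⊩ φ) → M , w ⊩ ψ

-- A set of formulas viewed as a set of standard formulas; loses nothing
-- when Φ ⊆ Standard.
_↾Standard : {𝒫 : Set a} → Pred (Formula 𝒫) b → Pred (StandardFormula 𝒫) b
(Φ ↾Standard) φ = proj₁ φ ∈ Φ

-- Standard formulas are flat: a team supports φ iff φ is Kripke-true at each of
-- its worlds.  Hence supporting teams and their singletons carry the same
-- information, and the two consequence relations agree.

{-# OPTIONS --safe #-}
module Submission where

open import Defs
open import Level using (Level; lift; lower)
open import Data.Empty.Polymorphic using (⊥-elim)
import Data.Empty as Empty
open import Data.Product using (_,_; proj₁; proj₂; _×_)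
open import Data.Sum using (inj₁; inj₂; [_,_]′)
open import Function.Bundles using (_⇔_; mk⇔)
open import Relation.Binary.PropositionalEquality using (refl)
open import Relation.Unary using (Pred; _∈_; _⊆_; ｛_｝)

open Model using (Team)

private variable
  a ℓ : Level
  𝒫 : Set a
  φ : Formula 𝒫

mutual
  -- Induction on `s`. The antecedent of `⇒` is contravariant, so each direction calls the other on
  -- it; hence the mutual recursion.
  support⇒truth : (M : Model 𝒫 ℓ) (t : Team M) (s : Standard φ) →
                  M , t ⊨ φ → ∀ w → w ∈ t → M , w ⊩ˢ s
  support⇒truth M t (atom p) h w w∈t = lift (lower h w w∈t)
  support⇒truth M t ⊥ h w w∈t = Empty.⊥-elim (lower h w w∈t)
  support⇒truth M t (s₁ ∧ s₂) (h₁ , h₂) w w∈t =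
    support⇒truth M t s₁ h₁ w w∈t , support⇒truth M t s₂ h₂ w w∈t
  support⇒truth M t (s₁ ∨ s₂) (t′ , t″ , (t⊆ , _) , h₁ , h₂) w w∈t =
    [ (λ w∈t′ → inj₁ (support⇒truth M t′ s₁ h₁ w w∈t′))
    , (λ w∈t″ → inj₂ (support⇒truth M t″ s₂ h₂ w w∈t″)) ]′ (t⊆ w∈t)
  support⇒truth M t (s₁ ⇒ s₂) h w w∈t w′ wRw′ w′⊩s₁ =
    -- Test the supported implication on the singleton of `w′`, which lies inside `R[ t ]` because
    -- `w` is in `t`.
    support⇒truth M ｛ w′ ｝ s₂
      (h ｛ w′ ｝ (λ { refl → w , w∈t , wRw′ })
        (truth⇒support M ｛ w′ ｝ s₁ (λ { _ refl → w′⊩s₁ })))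
      w′ refl

  truth⇒support : (M : Model 𝒫 ℓ) (t : Team M) (s : Standard φ) →
                  (∀ w → w ∈ t → M , w ⊩ˢ s) → M , t ⊨ φ
  truth⇒support M t (atom p) h = lift λ w w∈t → lower (h w w∈t)
  truth⇒support M t ⊥ h = lift λ w w∈t → ⊥-elim (h w w∈t)
  truth⇒support M t (s₁ ∧ s₂) h =
    truth⇒support M t s₁ (λ w w∈t → proj₁ (h w w∈t)) ,
    truth⇒support M t s₂ (λ w w∈t → proj₂ (h w w∈t))
  truth⇒support M t (s₁ ∨ s₂) h =
    -- Split `t` into the worlds where each disjunct is true. The two parts may overlap, so no
    -- choice between disjuncts is made.
    t∩ s₁ , t∩ s₂ ,
    ( (λ {w} w∈t → [ (λ x → inj₁ (w∈t , x)) , (λ y → inj₂ (w∈t , y)) ]′ (h w w∈t))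
    , [ proj₁ , proj₁ ]′ ) ,
    truth⇒support M (t∩ s₁) s₁ (λ _ → proj₂) ,
    truth⇒support M (t∩ s₂) s₂ (λ _ → proj₂)
    where
    t∩ : ∀ {χ} → Standard χ → Team M
    t∩ s w = w ∈ t × M , w ⊩ˢ s
  truth⇒support M t (s₁ ⇒ s₂) h t′ t′⊆R[t] t′⊨φ =
    truth⇒support M t′ s₂ λ w′ w′∈t′ →
      -- Each world of `t′` lies above some `w` in `t`, where the implication is true.
      let w , w∈t , wRw′ = t′⊆R[t] w′∈t′ in
      h w w∈t w′ wRw′ (support⇒truth M t′ s₁ t′⊨φ w′ w′∈t′)

theorem4p2 : ∀ {a b : Level} (ℓ : Level) (𝒫 : Set a)
    (Φ : Pred (Formula 𝒫) b) (ψ : Formula 𝒫) →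
    Φ ⊆ Standard → (ψ! : Standard ψ) →
    (Φ ⊨InqI[ ℓ ] ψ) ⇔ ((Φ ↾Standard) ⊨IPL[ ℓ ] (ψ , ψ!))
theorem4p2 ℓ 𝒫 Φ ψ Φ! ψ! = mk⇔
  (λ Φ⊨ψ M w w⊩Φ →
    -- Truth at `w` is read as support by its singleton, the team to which the hypothesis is
    -- applied.
    support⇒truth M ｛ w ｝ ψ!
      (Φ⊨ψ M ｛ w ｝ λ φ φ∈Φ →
        truth⇒support M ｛ w ｝ (Φ! φ∈Φ) λ { _ refl → w⊩Φ (φ , Φ! φ∈Φ) φ∈Φ })
      w refl)
  (λ Φ⊨ψ M t t⊨Φ →
    truth⇒support M t ψ! λ w w∈t →
      Φ⊨ψ M w λ (φ , φ!) φ∈Φ → support⇒truth M t φ! (t⊨Φ φ φ∈Φ) w w∈t)
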